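{- Let $\mathbf u$ be an infinite word over a finite alphabet whose language is closed under reversal, and suppose that: (1) both $D(\mathbf u)$ and $\sum_{n=0}^{+\infty}T_{\mathbf u}(n)$ are finite; (2) for every $M\in\mathbb N$ there exists a factor $w\in\mathcal L(\mathbf u)$ such that $w$ contains every factor of $\mathbf u$ of length $M$ and $ww\in\mathcal L(\mathbf u)$. Then $2D(\mathbf u)=\sum_{n=0}^{+\infty}T_{\mathbf u}(n)$.
   Context: $\mathcal L(\mathbf u)$ is the set of finite factors of $\mathbf u$, $\mathcal L_n(\mathbf u)$ those of length $n$. The reversal of $w=w_0\ldots w_{n-1}$ is $\overline w=w_{n-1}\ldots w_0$; a palindrome is a word equal to its reversal (including the empty word). The language is closed under reversal if $w\in\mathcal L(\mathbf u)$ implies $\overline w\in\mathcal L(\mathbf u)$. $\mathcal C_{\mathbf u}(n)=\#\mathcal L_n(\mathbf u)$; $\mathcal P_{\mathbf u}(n)$ is the number of palindromes in $\mathcal L_n(\mathbf u)$; $T_{\mathbf u}(n)=\mathcal C_{\mathbf u}(n+1)-\mathcal C_{\mathbf u}(n)+2-\mathcal P_{\mathbf u}(n+1)-\mathcal P_{\mathbf u}(n)$. The defect of a finite word $w$ is $D(w)=|w|+1$ minus the number of distinct palindromic factors of $w$ (including the empty word); $D(\mathbf u)=\sup\{D(w): w \text{ prefix of }\mathbf u\}$. -}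

module Defs where

open import Data.Nat using (ℕ; zero; suc; _+_; _≤_)
open import Data.Fin using (Fin)
open import Data.Fin.Properties using () renaming (_≟_ to _≟F_)
open import Data.List using (List; []; _∷_; length; reverse; filter; deduplicate; concatMap; inits; tails; _++_)
open import Data.List.Properties using (≡-dec)
open import Data.List.Membership.Propositional using (_∈_)
open import Data.List.Relation.Unary.All using (All)
open import Data.List.Relation.Unary.Unique.Propositional using (Unique)
open import Data.Integer using (ℤ; +_; _-_) renaming (_+_ to _+ℤ_)
open import Data.Product using (Σ; ∃; _×_)
open import Relation.Binary.PropositionalEquality using (_≡_)
open import Relation.Nullary using (Dec)
open import Data.Integer using () renaming (_≤_ to _≤ℤ_)

Word : ℕ → Set
Word k = ℕ → Fin k

slice : ∀ {k} → Word k → ℕ → ℕ → List (Fin k)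
slice u i zero = []
slice u i (suc n) = u i ∷ slice u (suc i) n

prefix : ∀ {k} → Word k → ℕ → List (Fin k)
prefix u n = slice u 0 n

Factor : ∀ {k} → Word k → List (Fin k) → Set
Factor u w = ∃ λ i → slice u i (length w) ≡ w

IsPalindrome : ∀ {A : Set} → List A → Set
IsPalindrome w = w ≡ reverse w

ClosedUnderReversal : ∀ {k} → Word k → Set
ClosedUnderReversal u = ∀ w → Factor u w → Factor u (reverse w)

HasCard : ∀ {A : Set} → (A → Set) → ℕ → Set
HasCard {A} P c = Σ (List A) λ xs →
  length xs ≡ c × Unique xs × All P xs × (∀ a → P a → a ∈ xs)

IsComplexity : ∀ {k} → Word k → ℕ → ℕ → Set
IsComplexity u n c = HasCard (λ w → Factor u w × length w ≡ n) c

IsPalComplexity : ∀ {k} → Word k → ℕ → ℕ → Set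
IsPalComplexity u n p =
  HasCard (λ w → Factor u w × length w ≡ n × IsPalindrome w) p

T : (ℕ → ℕ) → (ℕ → ℕ) → ℕ → ℤ
T C P n = ((+ C (suc n) - + C n) +ℤ + 2) - + P (suc n) - + P n

partialSum : (ℕ → ℤ) → ℕ → ℤ
partialSum f zero = f 0
partialSum f (suc m) = partialSum f m +ℤ f (suc m)

-- The series Σ_{n≥0} f n converges (in ℤ, i.e. partial sums eventually
-- constant) with sum S.
SeriesSum : (ℕ → ℤ) → ℤ → Set
SeriesSum f S = ∃ λ N → ∀ m → N ≤ m → partialSum f m ≡ S

factors : ∀ {A : Set} → List A → List (List A)
factors w = concatMap inits (tails w)

isPal? : ∀ {k} (w : List (Fin k)) → Dec (w ≡ reverse w)
isPal? w = ≡-dec _≟F_ w (reverse w)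

palFactors : ∀ {k} → List (Fin k) → List (List (Fin k))
palFactors w = deduplicate (≡-dec _≟F_) (filter isPal? (factors w))

-- D(w) = |w| + 1 − #(distinct palindromic factors, incl. empty word)
defect : ∀ {k} → List (Fin k) → ℤ
defect w = + suc (length w) - + length (palFactors w)

-- D(u) = d, with d finite: d = sup of the defects of the prefixes.
IsDefect : ∀ {k} → Word k → ℤ → Set
IsDefect u d = (∀ n → defect (prefix u n) ≤ℤ d)
             × (∃ λ n → defect (prefix u n) ≡ d)

FactorOf : ∀ {A : Set} → List A → List A → Set
FactorOf {A} v w = Σ (List A) λ x → Σ (List A) λ y → x ++ (v ++ y) ≡ w

{-# OPTIONS --safe #-}
module Submission where

-- Once the defect of the prefixes has stabilised, every further letter completes exactly one
-- new palindrome q, a suffix of the prefix read so far.  Fix m beyond that point and let x be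
-- the suffix of length m.  If x or its reversal occurred earlier, then |q| ≥ m, since otherwise
-- q, being a suffix of x and a prefix of its reversal, would have occurred earlier too.  If
-- neither did, then |q| ≥ m holds only when x is itself a palindrome (q = x), because a longer q
-- begins with the reversal of x.  So in a prefix v containing all factors of length m,
--   (|v| + 1 − m) − #(palindromes of length ≥ m in v) = (C(m) − P(m)) / 2,
-- and telescoping T(0) + … + T(m − 1) turns this into twice the defect of v.

open import Defs
open import Data.Nat using (ℕ; zero; suc; _≤_; _<_; _⊔_)
import Data.Nat as ℕ
import Data.Nat.Properties as ℕ
open import Data.Integer using (ℤ; +_; _*_)
import Data.Integer as ℤ
import Data.Integer.Properties as ℤ
open import Data.Integer.Tactic.RingSolver using (solve-∀)
open import Data.Fin using (Fin)
open import Data.Fin.Properties using () renaming (_≟_ to _≟F_)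
open import Data.List using (List; []; _∷_; length; _++_; reverse; inits; tails; filter)
open import Data.List.Properties using (≡-dec; length-++; length-reverse; reverse-++; reverse-involutive; ∷-injective)
open import Data.List.Membership.Propositional using (_∈_; find; lose)
open import Data.List.Membership.Propositional.Properties
open import Data.List.Membership.Propositional.Properties.WithK using (unique∧set⇒bag)
open import Data.List.Relation.Binary.BagAndSetEquality using (∼bag⇒↭)
open import Data.List.Relation.Binary.Permutation.Propositional.Properties using (↭-length)
open import Data.List.Relation.Unary.All as All using (All; []; _∷_)
import Data.List.Relation.Unary.All.Properties as All
open import Data.List.Relation.Unary.Any using (here; there; any?)
open import Data.List.Relation.Unary.AllPairs using ([]; _∷_)
import Data.List.Relation.Unary.Unique.Propositional.Properties as Unique
import Data.List.Relation.Unary.Unique.DecPropositional.Properties as UniqueDec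
import Data.List.Membership.DecPropositional as DecMembership
open import Data.Product using (Σ; ∃; _×_; _,_; proj₁; proj₂)
open import Data.Sum using (_⊎_; inj₁; inj₂; [_,_]′)
open import Function using (_∘_; id; mk⇔)
open import Relation.Binary.Definitions using (tri<; tri≈; tri>)
open import Relation.Binary.PropositionalEquality using (_≡_; refl; sym; trans; cong; cong₂; subst; module ≡-Reasoning)
open import Relation.Nullary using (¬_; Dec; yes; no; contradiction; ¬?)
open import Relation.Nullary.Decidable using (map′; decidable-stable)

sumBelow : (ℕ → ℕ) → ℕ → ℕ
sumBelow P zero = 0
sumBelow P (suc m) = sumBelow P m ℕ.+ P m

-- Cardinalities of predicates; factors of finite lists.

module _ {A : Set} where

  HasCard-cong : ∀ {P Q : A → Set} {c} → (∀ a → P a → Q a) → (∀ a → Q a → P a) →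
                 HasCard P c → HasCard Q c
  HasCard-cong to from (xs , len , uniq , sound , complete) =
    xs , len , uniq , All.map (to _) sound , λ a → complete a ∘ from a

  -- Duplicate-free lists with the same members are permutations of each other. This turns two
  -- descriptions of one set into an equation between numbers.
  HasCard-unique : ∀ {P : A → Set} {c c′} → HasCard P c → HasCard P c′ → c ≡ c′
  HasCard-unique (xs , refl , uxs , sxs , cxs) (ys , refl , uys , sys , cys) =
    ↭-length (∼bag⇒↭ (unique∧set⇒bag uxs uys
      (mk⇔ (cys _ ∘ All.lookup sxs) (cxs _ ∘ All.lookup sys))))

  HasCard-empty : ∀ {P : A → Set} → (∀ a → ¬ P a) → HasCard P 0
  HasCard-empty ¬P = [] , refl , [] , [] , λ a Pa → contradiction Pa (¬P a)

  HasCard-⊎ : ∀ {P Q : A → Set} {c c′} → (∀ a → P a → ¬ Q a) →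
              HasCard P c → HasCard Q c′ → HasCard (λ a → P a ⊎ Q a) (c ℕ.+ c′)
  HasCard-⊎ disj (xs , refl , uxs , sxs , cxs) (ys , refl , uys , sys , cys) =
    xs ++ ys , length-++ xs ,
    Unique.++⁺ uxs uys (λ (∈xs , ∈ys) → disj _ (All.lookup sxs ∈xs) (All.lookup sys ∈ys)) ,
    All.++⁺ (All.map inj₁ sxs) (All.map inj₂ sys) ,
    λ a → [ ∈-++⁺ˡ ∘ cxs a , ∈-++⁺ʳ xs ∘ cys a ]′

  HasCard-insert : ∀ {P Q : A → Set} {c} b → ¬ P b → Q b → (∀ a → P a → Q a) →
                   (∀ a → Q a → P a ⊎ a ≡ b) → HasCard P c → HasCard Q (suc c)
  HasCard-insert b ¬Pb Qb P⇒Q Q⇒ (xs , refl , uxs , sxs , cxs) =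
    b ∷ xs , refl ,
    All.tabulate (λ x∈xs b≡x → ¬Pb (subst _ (sym b≡x) (All.lookup sxs x∈xs))) ∷ uxs ,
    Qb ∷ All.map (P⇒Q _) sxs ,
    λ a Qa → [ there ∘ cxs a , here ]′ (Q⇒ a Qa)

  ++-injectiveˡ : ∀ (xs ys : List A) {xs′ ys′} → length xs ≡ length ys →
                  xs ++ xs′ ≡ ys ++ ys′ → xs ≡ ys
  ++-injectiveˡ [] [] _ _ = refl
  ++-injectiveˡ (x ∷ xs) (y ∷ ys) len eq with refl , eq′ ← ∷-injective eq =
    cong (x ∷_) (++-injectiveˡ xs ys (ℕ.suc-injective len) eq′)

  ∈-inits⁺ : ∀ (v y : List A) → v ∈ inits (v ++ y)
  ∈-inits⁺ [] y = here refl
  ∈-inits⁺ (a ∷ []) y = there (here refl)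
  -- A nonempty `v` is never the leading `[]` of `inits`, so only `there` remains.
  ∈-inits⁺ (a ∷ v@(b ∷ _)) y with ∈-inits⁺ v y
  ... | there v∈ = there (there (∈-map⁺ (a ∷_) v∈))

  ∈-inits⁻ : ∀ {v} (w : List A) → v ∈ inits w → ∃ λ y → v ++ y ≡ w
  ∈-inits⁻ w (here refl) = w , refl
  ∈-inits⁻ (a ∷ w) (there (here refl)) = w , refl
  ∈-inits⁻ (a ∷ w) (there (there v∈)) with v′ , v′∈ , refl ← ∈-map⁻ (a ∷_) v∈
    with y , eq ← ∈-inits⁻ w (there v′∈) = y , cong (a ∷_) eq

  ∈-tails⁺ : ∀ (x t : List A) → t ∈ tails (x ++ t)
  ∈-tails⁺ [] t = here refl
  ∈-tails⁺ (a ∷ x) t = there (∈-tails⁺ x t)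

  ∈-tails⁻ : ∀ {t} (w : List A) → t ∈ tails w → ∃ λ x → x ++ t ≡ w
  ∈-tails⁻ w (here refl) = [] , refl
  ∈-tails⁻ (a ∷ w) (there t∈) with x , eq ← ∈-tails⁻ w t∈ = a ∷ x , cong (a ∷_) eq

  FactorOf⇒∈factors : ∀ {v w : List A} → FactorOf v w → v ∈ factors w
  FactorOf⇒∈factors {v} (x , y , refl) =
    ∈-concatMap⁺ inits (lose (∈-tails⁺ x (v ++ y)) (∈-inits⁺ v y))

  ∈factors⇒FactorOf : ∀ {v} (w : List A) → v ∈ factors w → FactorOf v w
  ∈factors⇒FactorOf w v∈ with t , t∈ , v∈t ← find (∈-concatMap⁻ inits v∈)
    with y , refl ← ∈-inits⁻ t v∈t | x , eq ← ∈-tails⁻ w t∈ = x , y , eq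

-- Slices of the infinite word and occurrences in its prefixes.

module _ {k : ℕ} (u : Word k) where

  length-slice : ∀ i n → length (slice u i n) ≡ n
  length-slice i zero = refl
  length-slice i (suc n) = cong suc (length-slice (suc i) n)

  slice-++ : ∀ i a b → slice u i (a ℕ.+ b) ≡ slice u i a ++ slice u (i ℕ.+ a) b
  slice-++ i zero b = cong (λ j → slice u j b) (sym (ℕ.+-identityʳ i))
  slice-++ i (suc a) b = cong (u i ∷_) (trans (slice-++ (suc i) a b)
    (cong (λ j → slice u (suc i) a ++ slice u j b) (sym (ℕ.+-suc i a))))

  ++≡slice : ∀ x {r} i n → x ++ r ≡ slice u i n →
             slice u i (length x) ≡ x × r ≡ slice u (i ℕ.+ length x) (length r) × length x ℕ.+ length r ≡ n
  ++≡slice [] i n refl = refl ,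
    trans (cong (slice u i) (sym (length-slice i n))) (cong (λ j → slice u j (length (slice u i n))) (sym (ℕ.+-identityʳ i))) ,
    length-slice i n
  ++≡slice (a ∷ x) {r} i (suc n) eq with refl , eq′ ← ∷-injective eq
    with p , q , len ← ++≡slice x (suc i) n eq′ =
    cong (u i ∷_) p , trans q (cong (λ j → slice u j (length r)) (sym (ℕ.+-suc i (length x)))) , cong suc len

  -- The bound is on the end of the occurrence, so this is `FactorOf w (prefix u n)` with the
  -- starting index kept; comparing suffixes of a prefix becomes arithmetic on indices.
  OccursBefore : ℕ → List (Fin k) → Set
  OccursBefore n w = ∃ λ i → i ℕ.+ length w ≤ n × slice u i (length w) ≡ w

  slice-occurs : ∀ i l {n} → i ℕ.+ l ≤ n → OccursBefore n (slice u i l)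
  slice-occurs i l i+l≤n = i , subst (λ l′ → i ℕ.+ l′ ≤ _) (sym (length-slice i l)) i+l≤n ,
    cong (slice u i) (length-slice i l)

  OccursBefore-mono : ∀ {m n w} → m ≤ n → OccursBefore m w → OccursBefore n w
  OccursBefore-mono m≤n (i , le , eq) = i , ℕ.≤-trans le m≤n , eq

  OccursBefore⇒Factor : ∀ {n w} → OccursBefore n w → Factor u w
  OccursBefore⇒Factor (i , _ , eq) = i , eq

  OccursBefore-suc⁻ : ∀ {n w} → OccursBefore (suc n) w →
    OccursBefore n w ⊎ ∃ λ i → i ℕ.+ length w ≡ suc n × slice u i (length w) ≡ w
  OccursBefore-suc⁻ (i , le , eq) with ℕ.m≤n⇒m<n∨m≡n le
  ... | inj₁ lt = inj₁ (i , ℕ.≤-pred lt , eq)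
  ... | inj₂ e = inj₂ (i , e , eq)

  FactorOf⇒OccursBefore : ∀ {n v} → FactorOf v (prefix u n) → OccursBefore n v
  FactorOf⇒OccursBefore {n} {v} (x , y , eq) with _ , q , r ← ++≡slice x 0 n eq
    with p , _ , _ ← ++≡slice v (length x) _ q =
    length x , ℕ.≤-trans (ℕ.+-monoʳ-≤ (length x) (ℕ.m≤m+n (length v) (length y)))
      (ℕ.≤-reflexive (trans (cong (length x ℕ.+_) (sym (length-++ v))) r)) , p

  OccursBefore⇒FactorOf : ∀ {n v} → OccursBefore n v → FactorOf v (prefix u n)
  OccursBefore⇒FactorOf {n} {v} (i , le , eq) = prefix u i , slice u (i ℕ.+ length v) r , (begin
    prefix u i ++ v ++ slice u (i ℕ.+ length v) r
      ≡⟨ cong (λ z → prefix u i ++ z ++ slice u (i ℕ.+ length v) r) (sym eq) ⟩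
    prefix u i ++ slice u i (length v) ++ slice u (i ℕ.+ length v) r
      ≡⟨ cong (prefix u i ++_) (sym (slice-++ i (length v) r)) ⟩
    prefix u i ++ slice u i (length v ℕ.+ r)
      ≡⟨ sym (slice-++ 0 i (length v ℕ.+ r)) ⟩
    prefix u (i ℕ.+ (length v ℕ.+ r))
      ≡⟨ cong (prefix u) (trans (sym (ℕ.+-assoc i (length v) r)) (ℕ.m+[n∸m]≡n le)) ⟩
    prefix u n ∎)
    where
    open ≡-Reasoning
    r = n ℕ.∸ (i ℕ.+ length v)

  OccursBefore? : ∀ n w → Dec (OccursBefore n w)
  OccursBefore? n w = map′ (FactorOf⇒OccursBefore ∘ ∈factors⇒FactorOf (prefix u n))
    (FactorOf⇒∈factors ∘ OccursBefore⇒FactorOf) (w ∈? factors (prefix u n))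
    where open DecMembership (≡-dec _≟F_) using (_∈?_)

  -- Palindromes in prefixes and those completed by one more letter.

  palCount : ℕ → ℕ
  palCount n = length (palFactors (prefix u n))

  -- Replaces the computed list in `defect` by a predicate, to which the cardinality lemmas apply.
  palCount-card : ∀ n → HasCard (λ w → OccursBefore n w × IsPalindrome w) (palCount n)
  palCount-card n = palFactors (prefix u n) , refl , UniqueDec.deduplicate-! (≡-dec _≟F_) fs ,
    All.tabulate sound ,
    λ w (occ , pal) → ∈-deduplicate⁺ (≡-dec _≟F_) (∈-filter⁺ isPal? (FactorOf⇒∈factors (OccursBefore⇒FactorOf occ)) pal)
    where
    fs = filter isPal? (factors (prefix u n))
    sound : ∀ {w} → w ∈ palFactors (prefix u n) → OccursBefore n w × IsPalindrome w
    sound w∈ with w∈f , pal ← ∈-filter⁻ isPal? {xs = factors (prefix u n)} (∈-deduplicate⁻ (≡-dec _≟F_) fs w∈) =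
      FactorOf⇒OccursBefore (∈factors⇒FactorOf (prefix u n) w∈f) , pal

  -- Reversal exchanges the two ends of a palindrome: both sides are the first `b` letters of the
  -- same word.
  pal-slice : ∀ i a b → IsPalindrome (slice u i (a ℕ.+ b)) → slice u i b ≡ reverse (slice u (i ℕ.+ a) b)
  pal-slice i a b pal = ++-injectiveˡ _ _
    (trans (length-slice i b) (sym (trans (length-reverse (slice u (i ℕ.+ a) b)) (length-slice (i ℕ.+ a) b))))
    (begin
      slice u i b ++ slice u (i ℕ.+ b) a                     ≡⟨ sym (slice-++ i b a) ⟩
      slice u i (b ℕ.+ a)                                    ≡⟨ cong (slice u i) (ℕ.+-comm b a) ⟩
      slice u i (a ℕ.+ b)                                    ≡⟨ pal ⟩
      reverse (slice u i (a ℕ.+ b))                          ≡⟨ cong reverse (slice-++ i a b) ⟩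
      reverse (slice u i a ++ slice u (i ℕ.+ a) b)           ≡⟨ reverse-++ (slice u i a) _ ⟩
      reverse (slice u (i ℕ.+ a) b) ++ reverse (slice u i a) ∎)
    where open ≡-Reasoning

  -- The tail from `j` of the palindrome at `i` returns reversed at its front. As `i < j`, that copy
  -- lies at least one place further left and so ends within the first `n` letters.
  pal-border-occurs : ∀ {n} i j l l′ → i < j → i ℕ.+ l ≡ suc n → j ℕ.+ l′ ≡ suc n →
    IsPalindrome (slice u i l) → OccursBefore n (reverse (slice u j l′))
  pal-border-occurs {n} i j l l′ i<j i+l j+l′ pal =
    subst (OccursBefore n)
      (trans (pal-slice i a l′ (subst (IsPalindrome ∘ slice u i) l≡a+l′ pal))
             (cong (λ z → reverse (slice u z l′)) i+a≡j))
      (slice-occurs i l′ (ℕ.≤-pred (ℕ.≤-trans (ℕ.+-monoˡ-≤ l′ i<j) (ℕ.≤-reflexive j+l′))))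
    where
    a = j ℕ.∸ i
    i+a≡j : i ℕ.+ a ≡ j
    i+a≡j = ℕ.m+[n∸m]≡n (ℕ.<⇒≤ i<j)
    l≡a+l′ : l ≡ a ℕ.+ l′
    l≡a+l′ = ℕ.+-cancelˡ-≡ i l (a ℕ.+ l′) (trans i+l (sym
      (trans (sym (ℕ.+-assoc i a l′)) (trans (cong (ℕ._+ l′) i+a≡j) j+l′))))

  OccursBefore-++⁻ : ∀ {n} p {q} → OccursBefore n (p ++ q) → OccursBefore n p × OccursBefore n q
  OccursBefore-++⁻ {n} p {q} (i , le , eq) with e₁ , e₂ , _ ← ++≡slice p i _ (sym eq) =
    (i , ℕ.≤-trans (ℕ.+-monoʳ-≤ i (ℕ.m≤m+n _ _)) le′ , e₁) ,
    (i ℕ.+ length p , ℕ.≤-trans (ℕ.≤-reflexive (ℕ.+-assoc i _ _)) le′ , sym e₂)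
    where
    le′ : i ℕ.+ (length p ℕ.+ length q) ≤ n
    le′ = subst (λ z → i ℕ.+ z ≤ n) (length-++ p) le

  NewPal : ℕ → List (Fin k) → Set
  NewPal n q = IsPalindrome q × OccursBefore (suc n) q × ¬ OccursBefore n q

  NewPal-end : ∀ {n q} → NewPal n q → ∃ λ i → i ℕ.+ length q ≡ suc n × slice u i (length q) ≡ q
  NewPal-end (_ , occ , new) with OccursBefore-suc⁻ occ
  ... | inj₁ old = contradiction old new
  ... | inj₂ end = end

  palSuffix-occurs : ∀ {n p q i j} → i < j → i ℕ.+ length p ≡ suc n → j ℕ.+ length q ≡ suc n →
    slice u i (length p) ≡ p → slice u j (length q) ≡ q → IsPalindrome p → IsPalindrome q → OccursBefore n q
  palSuffix-occurs {i = i} {j} i<j i+p j+q p≡ q≡ pal-p pal-q = subst (OccursBefore _)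
    (trans (cong reverse q≡) (sym pal-q))
    (pal-border-occurs i j _ _ i<j i+p j+q (subst IsPalindrome (sym p≡) pal-p))

  -- A shorter palindromic suffix is also a prefix of the longer one, so it has occurred earlier.
  NewPal-unique : ∀ {n p q} → NewPal n p → NewPal n q → p ≡ q
  NewPal-unique {n} {p} {q} np@(pal-p , _ , new-p) nq@(pal-q , _ , new-q)
    with i , i+p , p≡ ← NewPal-end np | j , j+q , q≡ ← NewPal-end nq
    with ℕ.<-cmp i j
  ... | tri< i<j _ _ = contradiction (palSuffix-occurs i<j i+p j+q p≡ q≡ pal-p pal-q) new-q
  ... | tri> _ _ j<i = contradiction (palSuffix-occurs j<i j+q i+p q≡ p≡ pal-q pal-p) new-p
  ... | tri≈ _ refl _ = trans (sym p≡) (trans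
    (cong (slice u i) (ℕ.+-cancelˡ-≡ i _ _ (trans i+p (sym j+q)))) q≡)

  -- By `NewPal-unique` a letter completes at most one new palindrome; searching the finite list of
  -- palindromes of the longer prefix decides whether there is one.
  palCount-suc : ∀ n → (∃ (NewPal n) × palCount (suc n) ≡ suc (palCount n)) ⊎ palCount (suc n) ≡ palCount n
  palCount-suc n with any? (λ w → ¬? (OccursBefore? n w)) (palFactors (prefix u (suc n)))
  ... | yes some = inj₁ ((q , new) , HasCard-unique (palCount-card (suc n))
          (HasCard-insert q (λ (old , _) → proj₂ (proj₂ new) old) (proj₁ (proj₂ new) , proj₁ new)
             (λ a (occ , pal) → OccursBefore-mono (ℕ.n≤1+n n) occ , pal) split (palCount-card n)))
    where
    q = proj₁ (find some)
    new : NewPal n q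
    new with occ , pal ← All.lookup (proj₁ (proj₂ (proj₂ (proj₂ (palCount-card (suc n)))))) (proj₁ (proj₂ (find some)))
      = pal , occ , proj₂ (proj₂ (find some))
    split : ∀ a → OccursBefore (suc n) a × IsPalindrome a → (OccursBefore n a × IsPalindrome a) ⊎ a ≡ q
    split a (occ , pal) with OccursBefore? n a
    ... | yes old = inj₁ (old , pal)
    ... | no ¬old = inj₂ (NewPal-unique (pal , occ , ¬old) new)
  ... | no none = inj₂ (HasCard-unique (palCount-card (suc n)) (HasCard-cong
          (λ a (occ , pal) → OccursBefore-mono (ℕ.n≤1+n n) occ , pal)
          (λ a Qa → decidable-stable (OccursBefore? n a) (λ ¬old → none (lose (complete a Qa) ¬old)) , proj₂ Qa)
          (palCount-card n)))
    where complete = proj₂ (proj₂ (proj₂ (proj₂ (palCount-card (suc n)))))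

  -- The defect of prefixes and its stabilisation.

  defect-prefix : ∀ n → defect (prefix u n) ≡ + suc n ℤ.- + palCount n
  defect-prefix n = cong (λ l → + suc l ℤ.- + palCount n) (length-slice 0 n)

  defect-suc-old : ∀ n → palCount (suc n) ≡ palCount n → defect (prefix u (suc n)) ≡ ℤ.suc (defect (prefix u n))
  defect-suc-old n eq = trans (defect-prefix (suc n)) (trans
    (cong (λ c → + suc (suc n) ℤ.- + c) eq) (trans (ℤ.+-assoc (+ 1) (+ suc n) (ℤ.- + palCount n)) (cong ℤ.suc (sym (defect-prefix n)))))

  defect-suc-new : ∀ n → palCount (suc n) ≡ suc (palCount n) → defect (prefix u (suc n)) ≡ defect (prefix u n)
  defect-suc-new n eq = trans (defect-prefix (suc n)) (trans
    (cong (λ c → + suc (suc n) ℤ.- + c) eq) (trans (lemma (+ suc n) (+ palCount n)) (sym (defect-prefix n))))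
    where
    lemma : ∀ x y → (+ 1 ℤ.+ x) ℤ.- (+ 1 ℤ.+ y) ≡ x ℤ.- y
    lemma = solve-∀

  module _ {d : ℤ} (isDefect : IsDefect u d) where

    -- A letter completing no new palindrome would raise the defect from `d` to `d + 1`, above the
    -- supremum.
    defect-step : ∀ n → defect (prefix u n) ≡ d → ∃ (NewPal n) × defect (prefix u (suc n)) ≡ d
    defect-step n eq with palCount-suc n
    ... | inj₁ (new , e) = new , trans (defect-suc-new n e) eq
    ... | inj₂ e = contradiction
      (ℤ.≤-trans (ℤ.≤-reflexive (sym (trans (defect-suc-old n e) (cong ℤ.suc eq)))) (proj₁ isDefect (suc n)))
      (ℤ.<⇒≱ (ℤ.suc[i]≤j⇒i<j ℤ.≤-refl))

    defect-stable : ∀ {n} → proj₁ (proj₂ isDefect) ≤ n → defect (prefix u n) ≡ d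
    defect-stable le = go (ℕ.≤⇒≤′ le)
      where
      go : ∀ {n} → proj₁ (proj₂ isDefect) ℕ.≤′ n → defect (prefix u n) ≡ d
      go ℕ.≤′-refl = proj₂ (proj₂ isDefect)
      go (ℕ.≤′-step le′) = proj₂ (defect-step _ (go le′))

    NewPal-exists : ∀ {n} → proj₁ (proj₂ isDefect) ≤ n → ∃ (NewPal n)
    NewPal-exists le = proj₁ (defect-step _ (defect-stable le))

  -- Windows of length `m`: long palindromes against non-palindromes.

  LongPal : ℕ → ℕ → List (Fin k) → Set
  LongPal m n w = OccursBefore n w × IsPalindrome w × m ≤ length w

  -- A word counts as soon as it or its reversal has occurred, so the first window of a class of
  -- non-palindromes adds exactly two words.
  NonPal : ℕ → ℕ → List (Fin k) → Set
  NonPal m n w = (OccursBefore n w ⊎ OccursBefore n (reverse w)) × length w ≡ m × ¬ IsPalindrome w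

  -- `t` is the start of the last window `x` of length `m` in the prefix of length `suc n`, the one
  -- window added by the letter at position `n`.
  module Window {m n t : ℕ} (t+m : t ℕ.+ m ≡ suc n) where

    x : List (Fin k)
    x = slice u t m

    |x| : length x ≡ m
    |x| = length-slice t m

    |x̄| : length (reverse x) ≡ m
    |x̄| = trans (length-reverse x) |x|

    x-occurs : OccursBefore (suc n) x
    x-occurs = slice-occurs t m (ℕ.≤-reflexive t+m)

    occurs-split : ∀ {w} → length w ≡ m → OccursBefore (suc n) w → OccursBefore n w ⊎ w ≡ x
    occurs-split refl occ with OccursBefore-suc⁻ occ
    ... | inj₁ old = inj₁ old
    ... | inj₂ (i , e , eq) with refl ← ℕ.+-cancelʳ-≡ m i t (trans e (sym t+m)) = inj₂ (sym eq)

    NonPal-mono : ∀ {w} → NonPal m n w → NonPal m (suc n) w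
    NonPal-mono (inj₁ o , r) = inj₁ (OccursBefore-mono (ℕ.n≤1+n n) o) , r
    NonPal-mono (inj₂ o , r) = inj₂ (OccursBefore-mono (ℕ.n≤1+n n) o) , r

    NonPal-split : ∀ {w} → NonPal m (suc n) w → NonPal m n w ⊎ w ≡ x ⊎ w ≡ reverse x
    NonPal-split {w} (inj₁ o , len , np) with occurs-split len o
    ... | inj₁ old = inj₁ (inj₁ old , len , np)
    ... | inj₂ eq = inj₂ (inj₁ eq)
    NonPal-split {w} (inj₂ o , len , np) with occurs-split (trans (length-reverse w) len) o
    ... | inj₁ old = inj₁ (inj₂ old , len , np)
    ... | inj₂ eq = inj₂ (inj₂ (trans (sym (reverse-involutive w)) (cong reverse eq)))

    LongPal-mono : ∀ {w} → LongPal m n w → LongPal m (suc n) w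
    LongPal-mono (o , r) = OccursBefore-mono (ℕ.n≤1+n n) o , r

    LongPal-split : ∀ {w} → LongPal m (suc n) w → LongPal m n w ⊎ NewPal n w
    LongPal-split {w} (o , pal , le) with OccursBefore? n w
    ... | yes old = inj₁ (old , pal , le)
    ... | no ¬old = inj₂ (pal , o , ¬old)

    Seen : Set
    Seen = OccursBefore n x ⊎ OccursBefore n (reverse x)

    seen-x⇒NonPal : ∀ {w} → Seen → w ≡ x ⊎ w ≡ reverse x → OccursBefore n w ⊎ OccursBefore n (reverse w)
    seen-x⇒NonPal s (inj₁ refl) = s
    seen-x⇒NonPal (inj₁ o) (inj₂ refl) = inj₂ (subst (OccursBefore n) (sym (reverse-involutive x)) o)
    seen-x⇒NonPal (inj₂ o) (inj₂ refl) = inj₁ o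

    NewPal-short⇒¬Seen : ∀ {q} → NewPal n q → length q < m → ¬ Seen
    NewPal-short⇒¬Seen {q} nq@(pal , _ , new) lt seen with j , j+q , q≡ ← NewPal-end nq =
      new ([ occ , occ′ ]′ seen)
      where
      open ≡-Reasoning
      -- The offset of `q` inside `x`, since both end at the last letter.
      a = m ℕ.∸ length q
      m≡ : a ℕ.+ length q ≡ m
      m≡ = ℕ.m∸n+n≡m (ℕ.<⇒≤ lt)
      j≡ : t ℕ.+ a ≡ j
      j≡ = ℕ.+-cancelʳ-≡ (length q) _ _ (trans (ℕ.+-assoc t a _) (trans (cong (t ℕ.+_) m≡) (trans t+m (sym j+q))))
      x≡ : x ≡ slice u t a ++ q
      x≡ = begin
        slice u t m ≡⟨ cong (slice u t) (sym m≡) ⟩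
        slice u t (a ℕ.+ length q) ≡⟨ slice-++ t a (length q) ⟩
        slice u t a ++ slice u (t ℕ.+ a) (length q) ≡⟨ cong (λ z → slice u t a ++ slice u z (length q)) j≡ ⟩
        slice u t a ++ slice u j (length q) ≡⟨ cong (slice u t a ++_) q≡ ⟩
        slice u t a ++ q ∎
      occ : OccursBefore n x → OccursBefore n q
      occ o = proj₂ (OccursBefore-++⁻ (slice u t a) (subst (OccursBefore n) x≡ o))
      occ′ : OccursBefore n (reverse x) → OccursBefore n q
      occ′ o = proj₁ (OccursBefore-++⁻ q (subst (OccursBefore n) (begin
        reverse x ≡⟨ cong reverse x≡ ⟩
        reverse (slice u t a ++ q) ≡⟨ reverse-++ (slice u t a) q ⟩
        reverse q ++ reverse (slice u t a) ≡⟨ cong (_++ reverse (slice u t a)) (sym pal) ⟩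
        q ++ reverse (slice u t a) ∎) o))

    NewPal-long⇒Seen : ∀ {q} → NewPal n q → m ≤ length q → ¬ IsPalindrome x → Seen
    NewPal-long⇒Seen {q} nq@(pal , _ , new) le ¬pal with j , j+q , q≡ ← NewPal-end nq
      with ℕ.m≤n⇒m<n∨m≡n le
    -- Here `q` starts left of `x`, so it begins with a copy of `reverse x` that ends before the
    -- last letter.
    ... | inj₁ m<q = inj₂ (pal-border-occurs j t (length q) m j<t j+q t+m (subst IsPalindrome (sym q≡) pal))
      where
      j<t : j < t
      j<t = ℕ.+-cancelʳ-< m j t (ℕ.<-≤-trans (ℕ.+-monoʳ-< j m<q) (ℕ.≤-reflexive (trans j+q (sym t+m))))
    -- Equal lengths and equal ends force `q` to be `x`.
    ... | inj₂ refl with refl ← ℕ.+-cancelʳ-≡ m j t (trans j+q (sym t+m)) =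
      contradiction (subst IsPalindrome (sym q≡) pal) ¬pal

    -- The new palindrome cannot be short, so it is the one addition to `LongPal`. `NonPal` gains
    -- nothing, since `x` or its reversal was already there to account for both.
    seen-step : ∀ {b a q} → Seen → NewPal n q → HasCard (LongPal m n) b → HasCard (NonPal m n) a →
      HasCard (LongPal m (suc n)) (suc b) × HasCard (NonPal m (suc n)) a
    seen-step {q = q} seen nq@(pal , occ , new) hb ha =
      HasCard-insert q (new ∘ proj₁) (occ , pal , ℕ.≮⇒≥ (λ lt → NewPal-short⇒¬Seen nq lt seen))
        (λ _ → LongPal-mono) (λ _ lp → [ inj₁ , (λ np → inj₂ (NewPal-unique np nq)) ]′ (LongPal-split lp)) hb ,
      HasCard-cong (λ _ → NonPal-mono)
        (λ _ np → [ id , (λ eq → seen-x⇒NonPal seen eq , proj₂ np) ]′ (NonPal-split np)) ha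

    -- Here `x` itself is the new palindrome, and `NewPal-unique` excludes any other. It equals its
    -- reversal, so neither enters `NonPal`.
    pal-step : ∀ {b a} → ¬ Seen → IsPalindrome x → HasCard (LongPal m n) b → HasCard (NonPal m n) a →
      HasCard (LongPal m (suc n)) (suc b) × HasCard (NonPal m (suc n)) a
    pal-step ¬seen pal hb ha =
      HasCard-insert x (¬seen ∘ inj₁ ∘ proj₁) (x-occurs , pal , ℕ.≤-reflexive (sym |x|))
        (λ _ → LongPal-mono)
        (λ _ lp → [ inj₁ , (λ np → inj₂ (NewPal-unique np (pal , x-occurs , ¬seen ∘ inj₁))) ]′ (LongPal-split lp)) hb ,
      HasCard-cong (λ _ → NonPal-mono)
        (λ _ np → [ id , (λ eq → contradiction (subst IsPalindrome (sym ([ id , (λ e → trans e (sym pal)) ]′ eq)) pal)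
                                                (proj₂ (proj₂ np))) ]′ (NonPal-split np)) ha

    -- A new long palindrome would force `Seen`, so only `NonPal` grows.
    nonpal-step : ∀ {b a} → ¬ Seen → ¬ IsPalindrome x → HasCard (LongPal m n) b → HasCard (NonPal m n) a →
      HasCard (LongPal m (suc n)) b × HasCard (NonPal m (suc n)) (suc (suc a))
    nonpal-step ¬seen ¬pal hb ha =
      HasCard-cong (λ _ → LongPal-mono)
        (λ _ lp → [ id , (λ np → contradiction (NewPal-long⇒Seen np (proj₂ (proj₂ lp)) ¬pal) ¬seen) ]′ (LongPal-split lp)) hb ,
      -- Two stages: first `x`, then `reverse x`, which differs from it because `x` is no
      -- palindrome. The given `P` is the set in between.
      HasCard-insert {P = λ w → NonPal m n w ⊎ w ≡ x} (reverse x)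
        [ ¬seen ∘ reverse-seen ∘ proj₁ , ¬pal ∘ sym ]′
        (inj₂ (subst (OccursBefore (suc n)) (sym (reverse-involutive x)) x-occurs) , |x̄| ,
         (λ pal → ¬pal (trans (sym (reverse-involutive x)) (sym pal))))
        (λ _ → [ NonPal-mono , (λ { refl → inj₁ x-occurs , |x| , ¬pal }) ]′)
        (λ _ np → [ inj₁ ∘ inj₁ , [ inj₁ ∘ inj₂ , inj₂ ]′ ]′ (NonPal-split np))
        (HasCard-insert x (¬seen ∘ proj₁) (inj₂ refl) (λ _ → inj₁) (λ _ → id) ha)
      where
      reverse-seen : OccursBefore n (reverse x) ⊎ OccursBefore n (reverse (reverse x)) → Seen
      reverse-seen (inj₁ o) = inj₂ o
      reverse-seen (inj₂ o) = inj₁ (subst (OccursBefore n) (reverse-involutive x) o)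

  -- Each of the t windows of length suc M either completes a new palindrome of length ≥ suc M
  -- or opens a new class {x, reverse x} of two non-palindromes.
  window-count : ∀ M → (∀ n → M ≤ n → ∃ (NewPal n)) → ∀ t →
    ∃ λ b → ∃ λ a → HasCard (LongPal (suc M) (t ℕ.+ M)) b × HasCard (NonPal (suc M) (t ℕ.+ M)) a ×
      t ℕ.+ t ≡ b ℕ.+ b ℕ.+ a
  window-count M newPal zero = 0 , 0 ,
    -- With no windows the prefix has length `M`, too short for a word of length `suc M`.
    HasCard-empty (λ { w ((i , le , _) , _ , M<w) → ℕ.<⇒≱ M<w (ℕ.≤-trans (ℕ.m≤n+m _ i) le) }) ,
    HasCard-empty (λ { w (inj₁ (i , le , _) , len , _) → ℕ.<⇒≱ (ℕ.≤-reflexive (sym len)) (ℕ.≤-trans (ℕ.m≤n+m _ i) le)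
                     ; w (inj₂ (i , le , _) , len , _) → ℕ.<⇒≱ (ℕ.≤-reflexive (sym (trans (length-reverse w) len)))
                                                                (ℕ.≤-trans (ℕ.m≤n+m _ i) le) }) ,
    refl
  window-count M newPal (suc t) with b , a , hb , ha , eq ← window-count M newPal t = step
    where
    -- Passing from length `t + M` to `suc t + M` adds the window that starts at `t`.
    open Window {suc M} {t ℕ.+ M} {t} (ℕ.+-suc t M)
    b-grows : suc t ℕ.+ suc t ≡ suc b ℕ.+ suc b ℕ.+ a
    b-grows = cong suc (trans (ℕ.+-suc t t) (trans (cong suc eq) (cong (ℕ._+ a) (sym (ℕ.+-suc b b)))))
    a-grows : suc t ℕ.+ suc t ≡ b ℕ.+ b ℕ.+ suc (suc a)
    a-grows = trans (cong suc (ℕ.+-suc t t)) (trans (cong (suc ∘ suc) eq)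
      (sym (trans (ℕ.+-suc (b ℕ.+ b) (suc a)) (cong suc (ℕ.+-suc (b ℕ.+ b) a)))))
    step : ∃ λ b → ∃ λ a → HasCard (LongPal (suc M) (suc t ℕ.+ M)) b × HasCard (NonPal (suc M) (suc t ℕ.+ M)) a ×
      suc t ℕ.+ suc t ≡ b ℕ.+ b ℕ.+ a
    step with OccursBefore? (t ℕ.+ M) x | OccursBefore? (t ℕ.+ M) (reverse x) | isPal? x
    ... | yes o | _ | _ = let hb′ , ha′ = seen-step (inj₁ o) (proj₂ (newPal _ (ℕ.m≤n+m M t))) hb ha
                          in suc b , a , hb′ , ha′ , b-grows
    ... | no _ | yes o | _ = let hb′ , ha′ = seen-step (inj₂ o) (proj₂ (newPal _ (ℕ.m≤n+m M t))) hb ha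
                             in suc b , a , hb′ , ha′ , b-grows
    ... | no ¬o | no ¬o′ | yes pal = let hb′ , ha′ = pal-step [ ¬o , ¬o′ ]′ pal hb ha
                                     in suc b , a , hb′ , ha′ , b-grows
    ... | no ¬o | no ¬o′ | no ¬pal = let hb′ , ha′ = nonpal-step [ ¬o , ¬o′ ]′ ¬pal hb ha
                                     in b , suc (suc a) , hb′ , ha′ , a-grows

  -- Prefixes containing all factors up to a given length.

  all-occur : ∀ {ws} → All (Factor u) ws → ∃ λ n → All (OccursBefore n) ws
  all-occur [] = 0 , []
  all-occur {w ∷ _} ((i , eq) ∷ fs) with n , os ← all-occur fs =
    (i ℕ.+ length w) ⊔ n , (i , ℕ.m≤m⊔n _ n , eq) ∷ All.map (OccursBefore-mono (ℕ.m≤n⊔m (i ℕ.+ length w) n)) os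

  -- A factor of length at most `m` extends to the right to one of length `m`; these are finitely
  -- many, so their occurrences have a common bound.
  factors-occur : ∀ {m c} → IsComplexity u m c → ∃ λ n → ∀ w → Factor u w → length w ≤ m → OccursBefore n w
  factors-occur {m} (ws , _ , _ , sound , complete) with n , os ← all-occur (All.map proj₁ sound) = n , occ
    where
    occ : ∀ w → Factor u w → length w ≤ m → OccursBefore n w
    occ w (i , eq) le = proj₁ (OccursBefore-++⁻ w (subst (OccursBefore n)
      (trans (cong (slice u i) (sym (ℕ.m+[n∸m]≡n le)))
             (trans (slice-++ i (length w) _) (cong (_++ slice u (i ℕ.+ length w) (m ℕ.∸ length w)) eq)))
      (All.lookup os (complete (slice u i m) ((i , cong (slice u i) (length-slice i m)) , length-slice i m)))))

  shortPal-card : ∀ {P} → (∀ n → IsPalComplexity u n (P n)) → ∀ m →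
    HasCard (λ w → Factor u w × IsPalindrome w × length w < m) (sumBelow P m)
  shortPal-card hP zero = HasCard-empty (λ { _ (_ , _ , ()) })
  shortPal-card hP (suc m) = HasCard-cong
    (λ { w (inj₁ (f , pal , lt)) → f , pal , ℕ.m≤n⇒m≤1+n lt
       ; w (inj₂ (f , len , pal)) → f , pal , ℕ.≤-reflexive (cong suc len) })
    (λ w (f , pal , lt) → [ (λ l → inj₁ (f , pal , l)) , (λ e → inj₂ (f , e , pal)) ]′ (ℕ.m≤n⇒m<n∨m≡n (ℕ.≤-pred lt)))
    (HasCard-⊎ (λ w (_ , _ , lt) (_ , len , _) → ℕ.<⇒≢ lt len) (shortPal-card hP m) (hP m))

-- The differences of `C` telescope, and each value of `P` appears twice except the first and the
-- last. The leftover `P 0 - C 0` vanishes.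
partialSum-T : ∀ C P → C 0 ≡ P 0 → ∀ m → partialSum (T C P) m ≡
  + C (suc m) ℤ.- + P (suc m) ℤ.+ + 2 * (+ suc m) ℤ.- + 2 * + sumBelow P (suc m)
partialSum-T C P C₀≡P₀ zero = trans (cong (λ z → ((+ C 1 ℤ.- + z) ℤ.+ + 2) ℤ.- + P 1 ℤ.- + P 0) C₀≡P₀)
  (lemma (+ C 1) (+ P 1) (+ P 0))
  where
  lemma : ∀ c p₁ p₀ → ((c ℤ.- p₀) ℤ.+ + 2) ℤ.- p₁ ℤ.- p₀ ≡ c ℤ.- p₁ ℤ.+ + 2 * + 1 ℤ.- + 2 * p₀
  lemma = solve-∀
partialSum-T C P C₀≡P₀ (suc m) = trans
  (cong (ℤ._+ T C P (suc m)) (partialSum-T C P C₀≡P₀ m))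
  (trans (lemma (+ C (suc (suc m))) (+ C (suc m)) (+ P (suc (suc m))) (+ P (suc m)) (+ suc m) (+ sumBelow P (suc m)))
    (cong (λ z → + C (suc (suc m)) ℤ.- + P (suc (suc m)) ℤ.+ + 2 * (+ suc (suc m)) ℤ.- + 2 * z)
      (sym (ℤ.pos-+ (sumBelow P (suc m)) (P (suc m))))))
  where
  lemma : ∀ c₂ c₁ p₂ p₁ m s →
    (c₁ ℤ.- p₁ ℤ.+ + 2 * m ℤ.- + 2 * s) ℤ.+ (((c₂ ℤ.- c₁) ℤ.+ + 2) ℤ.- p₂ ℤ.- p₁)
      ≡ c₂ ℤ.- p₂ ℤ.+ + 2 * (+ 1 ℤ.+ m) ℤ.- + 2 * (s ℤ.+ p₁)
  lemma = solve-∀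

theorem3p4 : (k : ℕ) (u : Word k) → ClosedUnderReversal u →
    (C P : ℕ → ℕ) → (∀ n → IsComplexity u n (C n)) → (∀ n → IsPalComplexity u n (P n)) →
    (d S : ℤ) → IsDefect u d → SeriesSum (T C P) S →
    (∀ (M : ℕ) → Σ (List (Fin k)) λ w → Factor u w
        × (∀ v → Factor u v → length v ≡ M → FactorOf v w)
        × Factor u (w ++ w)) →
    + 2 * d ≡ S
theorem3p4 k u closed C P hC hP d S isDefect (N₀ , sums) _ = begin
  + 2 * d                                                         ≡⟨ cong (+ 2 *_) d≡ ⟩
  + 2 * (+ (t ℕ.+ m) ℤ.- + (sumBelow P m ℕ.+ b))                  ≡⟨ cong₂ (λ y z → + 2 * (y ℤ.- z)) (ℤ.pos-+ t m) (ℤ.pos-+ (sumBelow P m) b) ⟩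
  + 2 * ((+ t ℤ.+ + m) ℤ.- (+ sumBelow P m ℤ.+ + b))              ≡⟨ expand (+ t) (+ m) (+ sumBelow P m) (+ b) ⟩
  (+ t ℤ.+ + t) ℤ.+ + 2 * + m ℤ.- + 2 * + sumBelow P m ℤ.- (+ b ℤ.+ + b)
    ≡⟨ cong (λ z → z ℤ.+ + 2 * + m ℤ.- + 2 * + sumBelow P m ℤ.- (+ b ℤ.+ + b)) (cong +_ 2t≡) ⟩
  (+ b ℤ.+ + b ℤ.+ + a) ℤ.+ + 2 * + m ℤ.- + 2 * + sumBelow P m ℤ.- (+ b ℤ.+ + b)
    ≡⟨ collect (+ a) (+ b) (+ P m) (+ m) (+ sumBelow P m) ⟩
  (+ a ℤ.+ + P m) ℤ.- + P m ℤ.+ + 2 * + m ℤ.- + 2 * + sumBelow P m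
    ≡⟨ cong (λ z → z ℤ.- + P m ℤ.+ + 2 * + m ℤ.- + 2 * + sumBelow P m) (cong +_ a+P≡C) ⟩
  + C m ℤ.- + P m ℤ.+ + 2 * + m ℤ.- + 2 * + sumBelow P m          ≡⟨ sym (partialSum-T C P C₀≡P₀ M) ⟩
  partialSum (T C P) M                                            ≡⟨ sums M (ℕ.m≤m⊔n N₀ N₁) ⟩
  S                                                               ∎
  where
  open ≡-Reasoning
  N₁ = proj₁ (proj₂ isDefect)
  -- From `N₀` on the partial sums equal `S`; from `N₁` on the defect of the prefixes equals `d`.
  M = N₀ ⊔ N₁
  -- The partial sum up to `M` reaches `C (suc M)` and `P (suc M)`, which fixes the window length.
  m = suc M
  N₁≤M : N₁ ≤ M
  N₁≤M = ℕ.m≤n⊔m N₀ N₁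
  -- One number in two roles: a bound by which all factors of length at most `m` have occurred, and
  -- the number of windows of length `m` in the prefix of length `n = t + M`.
  t = proj₁ (factors-occur u (hC m))
  n = t ℕ.+ M
  occurs : ∀ w → Factor u w → length w ≤ m → OccursBefore u n w
  occurs w f le = OccursBefore-mono u (ℕ.m≤m+n t M) (proj₂ (factors-occur u (hC m)) w f le)
  counts = window-count u M (λ _ le → NewPal-exists u isDefect (ℕ.≤-trans N₁≤M le)) t
  b = proj₁ counts
  a = proj₁ (proj₂ counts)
  long = proj₁ (proj₂ (proj₂ counts))
  nonpal = proj₁ (proj₂ (proj₂ (proj₂ counts)))
  2t≡ : t ℕ.+ t ≡ b ℕ.+ b ℕ.+ a
  2t≡ = proj₂ (proj₂ (proj₂ (proj₂ counts)))

  -- All palindromes shorter than `m` have occurred by `n`, so the values of `P` count them; `b`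
  -- counts the others.
  palCount≡ : palCount u n ≡ sumBelow P m ℕ.+ b
  palCount≡ = HasCard-unique (palCount-card u n) (HasCard-cong
    (λ { w (inj₁ (f , pal , lt)) → occurs w f (ℕ.<⇒≤ lt) , pal
       ; w (inj₂ (occ , pal , _)) → occ , pal })
    (λ w (occ , pal) → [ (λ lt → inj₁ (OccursBefore⇒Factor u occ , pal , lt)) , (λ ge → inj₂ (occ , pal , ge)) ]′
                         (ℕ.<-≤-connex (length w) m))
    (HasCard-⊎ (λ w (_ , _ , lt) (_ , _ , ge) → ℕ.<⇒≱ lt ge) (shortPal-card u hP m) long))

  -- Every factor of length `m` has occurred by `n`, and closure under reversal keeps the words of
  -- `NonPal` inside the language, so they are exactly the non-palindromic factors of that length.
  a+P≡C : a ℕ.+ P m ≡ C m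
  a+P≡C = HasCard-unique (HasCard-cong
    (λ { w (inj₁ (inj₁ o , len , _)) → OccursBefore⇒Factor u o , len
       ; w (inj₁ (inj₂ o , len , _)) → subst (Factor u) (reverse-involutive w) (closed _ (OccursBefore⇒Factor u o)) , len
       ; w (inj₂ (f , len , _)) → f , len })
    split
    (HasCard-⊎ (λ w (_ , _ , ¬pal) (_ , _ , pal) → ¬pal pal) nonpal (hP m))) (hC m)
    where
    split : ∀ w → Factor u w × length w ≡ m → NonPal u m n w ⊎ (Factor u w × length w ≡ m × IsPalindrome w)
    split w (f , len) with isPal? w
    ... | yes pal = inj₂ (f , len , pal)
    ... | no ¬pal = inj₁ (inj₁ (occurs w f (ℕ.≤-reflexive len)) , len , ¬pal)

  C₀≡P₀ : C 0 ≡ P 0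
  C₀≡P₀ = HasCard-unique (hC 0) (HasCard-cong (λ w (f , len , _) → f , len)
    (λ { [] (f , len) → f , len , refl }) (hP 0))

  d≡ : d ≡ + (t ℕ.+ m) ℤ.- + (sumBelow P m ℕ.+ b)
  d≡ = trans (sym (defect-stable u isDefect (ℕ.≤-trans N₁≤M (ℕ.m≤n+m M t))))
    -- The `+ 1` in the defect turns `n = t + M` into `t + m`.
    (trans (defect-prefix u n) (cong₂ (λ y z → + y ℤ.- + z) (sym (ℕ.+-suc t M)) palCount≡))

  expand : ∀ t m s b → + 2 * ((t ℤ.+ m) ℤ.- (s ℤ.+ b)) ≡ (t ℤ.+ t) ℤ.+ + 2 * m ℤ.- + 2 * s ℤ.- (b ℤ.+ b)
  expand = solve-∀
  collect : ∀ a b p m s → (b ℤ.+ b ℤ.+ a) ℤ.+ + 2 * m ℤ.- + 2 * s ℤ.- (b ℤ.+ b)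
                        ≡ (a ℤ.+ p) ℤ.- p ℤ.+ + 2 * m ℤ.- + 2 * s
  collect = solve-∀
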